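{- Let $k,m$ be integers with $3\le k<m$. Then $$2\le \chi(mk,k)\le 3+\left\lceil\frac{(m-k)\cdot k}{k-1}\right\rceil.$$
   Context: For positive integers $k,N,d$ with $k\ge 3$, a $k$-term cyclic arithmetic progression mod $N$ with common difference $d$ is a $k$-element subset of $\mathbb{Z}_N=\mathbb{Z}/N\mathbb{Z}$ of the form $\{t,t+d,\ldots,t+(k-1)d\}$ for some $t\in\mathbb{Z}_N$ (so these $k$ elements are pairwise distinct mod $N$). $\chi(N,k)$ denotes the minimum number of subsets necessary to partition $\mathbb{Z}_N$ such that no subset in the partition contains any $k$-term cyclic arithmetic progression mod $N$. -}

module Defs where

open import Data.Fin using (Fin; toℕ; fromℕ<)
open import Data.Fin.Properties using (all?; any?; nonZeroIndex; toℕ-fromℕ<; fromℕ<-cong)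
  renaming (_≟_ to _≟ᶠ_)
open import Data.Fin.Subset using (Subset; _∈_; _⊆_; ∣_∣; Nonempty; ⁅_⁆)
open import Data.Fin.Subset.Properties
  using (_∈?_; _⊆?_; nonempty?; anySubset?; x∈⁅x⁆; x∈⁅y⁆⇒x≡y; ∣⁅x⁆∣≡1; p⊆q⇒∣p∣≤∣q∣)
open import Data.Nat
open import Data.Nat.DivMod
open import Data.Nat.Properties
open import Data.Product using (_×_; _,_; ∃; ∃-syntax; proj₁; proj₂)
open import Data.Vec using (Vec; []; _∷_; lookup; tabulate)
open import Data.Vec.Properties using (lookup∘tabulate)
open import Function using (_∘_; _⇔_; mk⇔; Equivalence)
open import Relation.Binary.PropositionalEquality
open import Relation.Nullary using (¬_; Dec; yes; no; contradiction)
open import Relation.Nullary.Decidable using (map′; _×-dec_; _→-dec_; ¬?)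
open import Relation.Unary using (Decidable)

private
  variable
    N c : ℕ

-- ℤ/Nℤ is represented by the residues Fin N; an inhabitant of Fin N
-- witnesses that the modulus N is nonzero.  This is t + j d in ℤ/Nℤ.
term : Fin N → ℕ → ℕ → Fin N
term {N} t d j = _mod_ (toℕ t + j * d) N {{nonZeroIndex t}}

-- size forces the k terms to be pairwise distinct.
record IsCyclicAP (k d : ℕ) (A : Subset N) : Set where
  constructor cyclicAP
  field
    size     : ∣ A ∣ ≡ k
    start    : Fin N
    elements : ∀ x → x ∈ A ⇔ (∃[ j ] x ≡ term start d (toℕ {k} j))

ContainsCyclicAP : ℕ → Subset N → Set
ContainsCyclicAP {N} k S =
  ∃[ d ] 1 ≤ d × ∃[ A ] IsCyclicAP {N} k d A × A ⊆ S

record IsPartition {N c : ℕ} (P : Vec (Subset N) c) : Set where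
  constructor partition
  field
    nonempty : ∀ i → Nonempty (lookup P i)
    covering : ∀ x → ∃[ i ] x ∈ lookup P i
    disjoint : ∀ i j x → x ∈ lookup P i → x ∈ lookup P j → i ≡ j

APFreePartition : (N k c : ℕ) → Set
APFreePartition N k c =
  ∃[ P ] IsPartition {N} {c} P × (∀ i → ¬ ContainsCyclicAP k (lookup P i))

IsMinimum : (ℕ → Set) → ℕ → Set
IsMinimum Q c = Q c × (∀ {b} → Q b → c ≤ b)

------------------------------------------------------------------------
-- The minimum exists: its defining property is decidable, and for k ≥ 2
-- the partition into singletons has it.

private
  ⇔-dec : ∀ {A B : Set} → Dec A → Dec B → Dec (A ⇔ B)
  ⇔-dec a b = map′ (λ (f , g) → mk⇔ f g)
                   (λ e → Equivalence.to e , Equivalence.from e)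
                   ((a →-dec b) ×-dec (b →-dec a))

isCyclicAP? : ∀ k d (A : Subset N) → Dec (IsCyclicAP k d A)
isCyclicAP? k d A = map′
  (λ (s , t , e) → cyclicAP s t e) (λ (cyclicAP s t e) → s , t , e)
  (∣ A ∣ ≟ k ×-dec any? λ t → all? λ x →
    ⇔-dec (x ∈? A) (any? λ j → x ≟ᶠ term t d (toℕ j)))

-- Replacing d by d % N + N changes no term, so d ranges over a finite set.
term-reduce : ∀ (t : Fin N) d j .{{_ : NonZero N}} → term t d j ≡ term t (d % N + N) j
term-reduce {N} t d j = fromℕ<-cong _ _ eq _ _
  where
  d≡ : d % N + N + d / N * N ≡ d + 1 * N
  d≡ = begin
    d % N + N + d / N * N    ≡⟨ +-assoc (d % N) N _ ⟩
    d % N + (N + d / N * N)  ≡⟨ cong (d % N +_) (+-comm N _) ⟩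
    d % N + (d / N * N + N)  ≡⟨ +-assoc (d % N) _ N ⟨
    d % N + d / N * N + N    ≡⟨ cong₂ _+_ (m≡m%n+[m/n]*n d N) (*-identityˡ N) ⟨
    d + 1 * N                ∎
    where open ≡-Reasoning
  d%≡ : d % N ≡ (d % N + N) % N
  d%≡ = trans (sym ([m+kn]%n≡m%n d 1 N))
       (trans (cong (_% N) (sym d≡)) ([m+kn]%n≡m%n (d % N + N) (d / N) N))
  jd≡ : (j * d) % N ≡ (j * (d % N + N)) % N
  jd≡ = trans (%-distribˡ-* j d N)
       (trans (cong (λ r → (j % N * r) % N) d%≡) (sym (%-distribˡ-* j (d % N + N) N)))
  eq : (toℕ t + j * d) % N ≡ (toℕ t + j * (d % N + N)) % N
  eq = trans (%-distribˡ-+ (toℕ t) (j * d) N)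
      (trans (cong (λ r → (toℕ t % N + r) % N) jd≡)
             (sym (%-distribˡ-+ (toℕ t) (j * (d % N + N)) N)))

containsCyclicAP? : ∀ k → Decidable (ContainsCyclicAP {N} k)
containsCyclicAP? {N} k S = map′ to from
  (any? λ (r : Fin N) → anySubset? λ A → isCyclicAP? k (toℕ r + N) A ×-dec A ⊆? S)
  where
  to : (∃[ r ] ∃[ A ] IsCyclicAP k (toℕ {N} r + N) A × A ⊆ S) → ContainsCyclicAP k S
  to (r , A , ap , A⊆S) =
    toℕ r + N , ≤-trans (>-nonZero⁻¹ N {{nonZeroIndex r}}) (m≤n+m N (toℕ r)) , A , ap , A⊆S
  from : ContainsCyclicAP k S → ∃[ r ] ∃[ A ] IsCyclicAP k (toℕ {N} r + N) A × A ⊆ S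
  from (d , _ , A , cyclicAP s t e , A⊆S) = r , A , cyclicAP s t e′ , A⊆S
    where
    instance
      N≢0 : NonZero N
      N≢0 = nonZeroIndex t
    r : Fin N
    r = d mod N
    same : ∀ j → term t d j ≡ term t (toℕ r + N) j
    same j = trans (term-reduce t d j)
      (cong (λ q → term t (q + N) j) (sym (toℕ-fromℕ< (m%n<n d N))))
    e′ : ∀ x → x ∈ A ⇔ (∃[ j ] x ≡ term t (toℕ r + N) (toℕ {k} j))
    e′ x = mk⇔
      (λ x∈A → let j , p = Equivalence.to (e x) x∈A in j , trans p (same (toℕ j)))
      (λ (j , p) → Equivalence.from (e x) (j , trans p (sym (same (toℕ j)))))

isPartition? : (P : Vec (Subset N) c) → Dec (IsPartition P)
isPartition? P = map′
  (λ (n , v , d) → partition n v d) (λ (partition n v d) → n , v , d)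
  ( all? (λ i → nonempty? (lookup P i))
  ×-dec all? (λ x → any? λ i → x ∈? lookup P i)
  ×-dec all? (λ i → all? λ j → all? λ x →
          x ∈? lookup P i →-dec (x ∈? lookup P j →-dec i ≟ᶠ j)))

private
  anyVec? : ∀ c {Q : Vec (Subset N) c → Set} → Decidable Q → Dec (∃ Q)
  anyVec? zero    Q? = map′ ([] ,_) (λ { ([] , q) → q }) (Q? [])
  anyVec? (suc c) Q? = map′
    (λ (S , P , q) → S ∷ P , q) (λ { (S ∷ P , q) → S , P , q })
    (anySubset? λ S → anyVec? c λ P → Q? (S ∷ P))

apFreePartition? : ∀ N k → Decidable (APFreePartition N k)
apFreePartition? N k c = anyVec? c λ P →
  isPartition? P ×-dec all? λ i → ¬? (containsCyclicAP? k (lookup P i))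

private
  minimum : ∀ {Q : ℕ → Set} → Decidable Q → ∀ n → Q n → ∃ (IsMinimum Q)
  minimum Q? zero q = 0 , q , λ _ → z≤n
  minimum {Q} Q? (suc n) q with Q? 0
  ... | yes q₀ = 0 , q₀ , λ _ → z≤n
  ... | no ¬q₀ with minimum (Q? ∘ suc) n q
  ...   | m , qm , least = suc m , qm , λ {b} → bound b
    where
    bound : ∀ b → Q b → suc m ≤ b
    bound zero    q₀ = contradiction q₀ ¬q₀
    bound (suc b) qb = s≤s (least qb)

singletons : ∀ N k → 2 ≤ k → APFreePartition N k N
singletons N k 2≤k = P , partition nonempty covering disjoint , apFree
  where
  P : Vec (Subset N) N
  P = tabulate ⁅_⁆
  P≡ : ∀ i → lookup P i ≡ ⁅ i ⁆
  P≡ = lookup∘tabulate ⁅_⁆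
  self : ∀ i → i ∈ lookup P i
  self i = subst (i ∈_) (sym (P≡ i)) (x∈⁅x⁆ i)
  only : ∀ i {x} → x ∈ lookup P i → x ≡ i
  only i {x} x∈ = x∈⁅y⁆⇒x≡y i (subst (x ∈_) (P≡ i) x∈)
  nonempty : ∀ i → Nonempty (lookup P i)
  nonempty i = i , self i
  covering : ∀ x → ∃[ i ] x ∈ lookup P i
  covering x = x , self x
  disjoint : ∀ i j x → x ∈ lookup P i → x ∈ lookup P j → i ≡ j
  disjoint i j x x∈i x∈j = trans (sym (only i x∈i)) (only j x∈j)
  apFree : ∀ i → ¬ ContainsCyclicAP k (lookup P i)
  apFree i (_ , _ , A , cyclicAP s _ _ , A⊆) = <⇒≱ 2≤k (begin
    k               ≡⟨ s ⟨
    ∣ A ∣           ≤⟨ p⊆q⇒∣p∣≤∣q∣ A⊆ ⟩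
    ∣ lookup P i ∣  ≡⟨ cong ∣_∣ (P≡ i) ⟩
    ∣ ⁅ i ⁆ ∣       ≡⟨ ∣⁅x⁆∣≡1 i ⟩
    1               ∎)
    where open ≤-Reasoning

χ-exists : ∀ N k → 3 ≤ k → ∃ (IsMinimum (APFreePartition N k))
χ-exists N k 3≤k =
  minimum (apFreePartition? N k) N (singletons N k (≤-trans (n≤1+n 2) 3≤k))

-- The hypothesis 3 ≤ k is only used to show that the minimum exists.
χ : ∀ N k → 3 ≤ k → ℕ
χ N k 3≤k = proj₁ (χ-exists N k 3≤k)

χ-isMinimum : ∀ N k (3≤k : 3 ≤ k) → IsMinimum (APFreePartition N k) (χ N k 3≤k)
χ-isMinimum N k 3≤k = proj₂ (χ-exists N k 3≤k)

k∸1-nonZero : ∀ {k} → 3 ≤ k → NonZero (k ∸ 1)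
k∸1-nonZero (s≤s (s≤s _)) = _

{-# OPTIONS --safe #-}

-- A progression in ℤ/mkℤ is determined by its first two terms, so fewer than
-- k⁴ of them lie in {0, …, k² − 1}.  For k ≥ 9 we have k⁴ ≤ 3^(k−1), and the
-- union bound gives a 3-colouring of these k² residues without monochromatic
-- progressions; for k ≤ 8 such colourings are given explicitly.  The other
-- (m − k)k residues are cut into blocks of k − 1.  For the lower bound,
-- 0, 1, …, k − 1 is a progression.

module Submission where

open import Defs

module Colourings where

  open import Data.Bool.Base using (if_then_else_)
  open import Data.Fin.Base
    using (Fin; zero; suc; toℕ; fromℕ<; inject≤; punchIn; punchOut; splitAt; join)
  open import Data.Fin.Patterns using (0F; 1F; 2F)
  open import Data.Fin.Properties as Fin
    using (toℕ-fromℕ<; toℕ-injective; toℕ-inject≤; toℕ<n; nonZeroIndex; punchIn-punchOut;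
           splitAt-join; ¬∀⟶∃¬)
  open import Data.Fin.Subset using (Subset; _∈_; ∣_∣; ∁; inside; outside; ⁅_⁆)
  open import Data.Fin.Subset.Properties
    using (∣∁p∣≡n∸∣p∣; ∣p∣≤n; p⊆q⇒∣p∣≤∣q∣; ∣⁅x⁆∣≡1; x∈⁅x⁆; ⊆-antisym)
  open import Data.List.Base
    using (List; []; _∷_; length; map; filter; cartesianProductWith; cartesianProduct; allFin)
  open import Data.List.Membership.Propositional using (lose) renaming (_∈_ to _∈ˡ_)
  open import Data.List.Membership.Propositional.Properties
    using (∈-map⁺; ∈-allFin; ∈-filter⁺; ∈-filter⁻; ∈-cartesianProduct⁺; ∈-cartesianProduct⁻;
           ∈-cartesianProductWith⁺)
  open import Data.List.Properties
    using (length-++; length-map; length-tabulate; filter-notAll)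
  open import Data.List.Relation.Unary.All as All using (All; []; _∷_)
  open import Data.Nat.Base
  open import Data.Nat.DivMod
  open import Data.Nat.ListAction using (sum)
  open import Data.Nat.Properties
  open import Data.Nat.Tactic.RingSolver using (solve-∀)
  open import Data.Product.Base using (_×_; _,_; ∃-syntax; proj₁; proj₂)
  open import Data.Sum.Base using (_⊎_; inj₁; inj₂)
  open import Data.Sum.Properties using (inj₁-injective; inj₂-injective)
  open import Data.Vec.Base using ([]; _∷_; here; there; lookup; tabulate)
  import Data.Vec.Functional as Functional
  open import Data.Vec.Properties using (lookup∘tabulate; lookup⇒[]=; []=⇒lookup)
  open import Function.Base using (_∘_)
  open import Function.Bundles using (mk⇔; module Equivalence)
  open import Relation.Binary.PropositionalEquality
  open import Relation.Nullary using (¬_; Dec; yes; no; does; contradiction)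
  open import Relation.Nullary.Decidable
    using (toWitness; ¬?; _×-dec_; _→-dec_; dec-true)
  open import Relation.Unary using (Decidable)

  -- Decidable subsets and cardinality bounds

  subset : ∀ {n} {P : Fin n → Set} → Decidable P → Subset n
  subset P? = tabulate (does ∘ P?)

  ∈-subset⁺ : ∀ {n} {P : Fin n → Set} (P? : Decidable P) {x} → P x → x ∈ subset P?
  ∈-subset⁺ P? {x} p = lookup⇒[]= x _ (trans (lookup∘tabulate (does ∘ P?) x) (dec-true (P? x) p))

  ∈-subset⁻ : ∀ {n} {P : Fin n → Set} (P? : Decidable P) {x} → x ∈ subset P? → P x
  ∈-subset⁻ P? {x} x∈ with P? x | trans (sym (lookup∘tabulate (does ∘ P?) x)) ([]=⇒lookup x∈)
  ... | yes p | _ = p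

  ∣p∣≤1 : ∀ {n} {A : Subset n} y → (∀ {x} → x ∈ A → x ≡ y) → ∣ A ∣ ≤ 1
  ∣p∣≤1 {A = A} y A⊆y = begin
    ∣ A ∣      ≤⟨ p⊆q⇒∣p∣≤∣q∣ (λ x∈A → subst (_∈ ⁅ y ⁆) (sym (A⊆y x∈A)) (x∈⁅x⁆ y)) ⟩
    ∣ ⁅ y ⁆ ∣  ≡⟨ ∣⁅x⁆∣≡1 y ⟩
    1          ∎
    where open ≤-Reasoning

  -- Induction along the vector: `lo` drops until the interval begins, and from then on every
  -- element of `A` uses up one unit of `l`.
  ∣interval∣≤ : ∀ {n} (A : Subset n) lo l →
    (∀ {x} → x ∈ A → lo ≤ toℕ x × toℕ x < lo + l) → ∣ A ∣ ≤ l
  ∣interval∣≤ [] _ _ _ = z≤n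
  ∣interval∣≤ (outside ∷ A) zero l A⊆ =
    ∣interval∣≤ A zero l λ x∈A → z≤n , <-trans (n<1+n _) (proj₂ (A⊆ (there x∈A)))
  ∣interval∣≤ (inside ∷ A) zero zero A⊆ = contradiction (proj₂ (A⊆ here)) λ ()
  ∣interval∣≤ (inside ∷ A) zero (suc l) A⊆ =
    s≤s (∣interval∣≤ A zero l λ x∈A → z≤n , s<s⁻¹ (proj₂ (A⊆ (there x∈A))))
  ∣interval∣≤ (outside ∷ A) (suc lo) l A⊆ =
    ∣interval∣≤ A lo l λ x∈A → let lo≤ , <hi = A⊆ (there x∈A) in s≤s⁻¹ lo≤ , s<s⁻¹ <hi
  ∣interval∣≤ (inside ∷ A) (suc lo) l A⊆ = contradiction (proj₁ (A⊆ here)) λ ()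

  -- Colourings and partitions

  NoMonochromaticAP : ∀ {N B} → ℕ → (Fin N → Fin B) → Set
  NoMonochromaticAP k h = ∀ {d A} → IsCyclicAP k d A → ∀ j → ¬ (∀ {x} → x ∈ A → h x ≡ j)

  colouring⇒partition : ∀ {N k} B (h : Fin N → Fin B) → NoMonochromaticAP k h →
    ∃[ c ] c ≤ B × APFreePartition N k c
  colouring⇒partition {N} {k} B h free with Fin.all? (λ j → Fin.any? λ x → h x Fin.≟ j)
  colouring⇒partition {N} {k} B h free | yes onto =
    B , ≤-refl , P , partition
      (λ j → let x , hx≡j = onto j in x , ∈P⁺ j hx≡j)
      (λ x → h x , ∈P⁺ (h x) refl)
      (λ i j x x∈i x∈j → trans (sym (∈P⁻ i x∈i)) (∈P⁻ j x∈j))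
      , λ j (d , _ , A , ap , A⊆) → free ap j (∈P⁻ j ∘ A⊆)
    where
    class? : ∀ j → Decidable (λ x → h x ≡ j)
    class? j x = h x Fin.≟ j
    P = tabulate (subset ∘ class?)
    ∈P⁺ : ∀ j {x} → h x ≡ j → x ∈ lookup P j
    ∈P⁺ j {x} e = subst (x ∈_) (sym (lookup∘tabulate (subset ∘ class?) j)) (∈-subset⁺ (class? j) e)
    ∈P⁻ : ∀ j {x} → x ∈ lookup P j → h x ≡ j
    ∈P⁻ j {x} e = ∈-subset⁻ (class? j) (subst (x ∈_) (lookup∘tabulate (subset ∘ class?) j) e)
  colouring⇒partition B h free | no ¬onto
    with ¬∀⟶∃¬ B _ (λ j → Fin.any? λ x → h x Fin.≟ j) ¬onto
  colouring⇒partition (suc B) h free | no ¬onto | j , unused =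
    let c , c≤B , P = colouring⇒partition B (λ x → punchOut (j≢h x)) λ ap i mono →
          free ap (punchIn j i) λ x∈A →
            trans (sym (punchIn-punchOut (j≢h _))) (cong (punchIn j) (mono x∈A))
    in c , m≤n⇒m≤1+n c≤B , P
    where
    j≢h : ∀ x → j ≢ h x
    j≢h x j≡hx = unused (x , sym j≡hx)

  χ≤ : ∀ {N k B} (3≤k : 3 ≤ k) (h : Fin N → Fin B) → NoMonochromaticAP k h → χ N k 3≤k ≤ B
  χ≤ {N} {k} {B} 3≤k h free with c , c≤B , P ← colouring⇒partition B h free =
    ≤-trans (proj₂ (χ-isMinimum N k 3≤k) P) c≤B

  -- Arithmetic progressions

  module _ {m m′ n n′ : ℕ} (N : ℕ) .{{_ : NonZero N}} where

    %-cong-+ : m % N ≡ m′ % N → n % N ≡ n′ % N → (m + n) % N ≡ (m′ + n′) % N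
    %-cong-+ p q = begin
      (m + n) % N            ≡⟨ %-distribˡ-+ m n N ⟩
      (m % N + n % N) % N    ≡⟨ cong₂ (λ a b → (a + b) % N) p q ⟩
      (m′ % N + n′ % N) % N  ≡⟨ %-distribˡ-+ m′ n′ N ⟨
      (m′ + n′) % N          ∎
      where open ≡-Reasoning

    %-cong-* : m % N ≡ m′ % N → n % N ≡ n′ % N → (m * n) % N ≡ (m′ * n′) % N
    %-cong-* p q = begin
      (m * n) % N                ≡⟨ %-distribˡ-* m n N ⟩
      ((m % N) * (n % N)) % N    ≡⟨ cong₂ (λ a b → (a * b) % N) p q ⟩
      ((m′ % N) * (n′ % N)) % N  ≡⟨ %-distribˡ-* m′ n′ N ⟨
      (m′ * n′) % N              ∎
      where open ≡-Reasoning

  module _ {N : ℕ} (t : Fin N) where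

    private instance
      N≢0 : NonZero N
      N≢0 = nonZeroIndex t

    toℕ-term : ∀ d j → toℕ (term t d j) ≡ (toℕ t + j * d) % N
    toℕ-term d j = toℕ-fromℕ< _

    term-cong : ∀ {d e} j → d % N ≡ e % N → term t d j ≡ term t e j
    term-cong {d} {e} j d≡e = toℕ-injective (begin
      toℕ (term t d j)     ≡⟨ toℕ-term d j ⟩
      (toℕ t + j * d) % N  ≡⟨ %-cong-+ {toℕ t} N refl (%-cong-* {j} N refl d≡e) ⟩
      (toℕ t + j * e) % N  ≡⟨ toℕ-term e j ⟨
      toℕ (term t e j)     ∎)
      where open ≡-Reasoning

    -- A representative of b − t modulo N.
    difference : Fin N → ℕ
    difference b = toℕ b + (N ∸ toℕ t)

    difference-term : ∀ d → difference (term t d 1) % N ≡ d % N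
    difference-term d = begin
      (toℕ (term t d 1) + (N ∸ toℕ t)) % N         ≡⟨ cong (λ b → (b + (N ∸ toℕ t)) % N) (toℕ-term d 1) ⟩
      ((toℕ t + 1 * d) % N + (N ∸ toℕ t)) % N      ≡⟨ %-cong-+ {n = N ∸ toℕ t} N (m%n%n≡m%n (toℕ t + 1 * d) N) refl ⟩
      (toℕ t + 1 * d + (N ∸ toℕ t)) % N            ≡⟨ cong (_% N) (shuffle (toℕ t) d (N ∸ toℕ t)) ⟩
      (d + (toℕ t + (N ∸ toℕ t))) % N              ≡⟨ cong (λ n → (d + n) % N) (m+[n∸m]≡n (<⇒≤ (toℕ<n t))) ⟩
      (d + N) % N                                  ≡⟨ [m+n]%n≡m%n d N ⟩
      d % N                                        ∎
      where
      open ≡-Reasoning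
      shuffle : ∀ t d u → t + 1 * d + u ≡ d + (t + u)
      shuffle = solve-∀

    -- The first two terms determine `d` modulo `N`, hence all terms. This lets progressions be
    -- counted, and tabulated, by pairs of residues.
    term-difference : ∀ d j → term t d j ≡ term t (difference (term t d 1)) j
    term-difference d j = term-cong j (sym (difference-term d))

    term-zero : ∀ d → term t d 0 ≡ t
    term-zero d = toℕ-injective (begin
      toℕ (term t d 0)  ≡⟨ toℕ-term d 0 ⟩
      (toℕ t + 0) % N   ≡⟨ cong (_% N) (+-identityʳ (toℕ t)) ⟩
      toℕ t % N         ≡⟨ m<n⇒m%n≡m (toℕ<n t) ⟩
      toℕ t             ∎)
      where open ≡-Reasoning

    -- `difference t` equals `N`, so a progression that repeats its first term is constant.
    term-difference-self : ∀ j → term t (difference t) j ≡ t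
    term-difference-self j = toℕ-injective (begin
      toℕ (term t (difference t) j)   ≡⟨ toℕ-term (difference t) j ⟩
      (toℕ t + j * difference t) % N  ≡⟨ cong (λ d → (toℕ t + j * d) % N) (m+[n∸m]≡n (<⇒≤ (toℕ<n t))) ⟩
      (toℕ t + j * N) % N             ≡⟨ [m+kn]%n≡m%n (toℕ t) j N ⟩
      toℕ t % N                       ≡⟨ m<n⇒m%n≡m (toℕ<n t) ⟩
      toℕ t                           ∎)
      where open ≡-Reasoning

  module _ {N k d : ℕ} {A : Subset N} (ap : IsCyclicAP k d A) where

    open IsCyclicAP ap

    term∈ : ∀ {j} → j < k → term start d j ∈ A
    term∈ j<k = Equivalence.from (elements _)
      (fromℕ< j<k , cong (term start d) (sym (toℕ-fromℕ< j<k)))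

    start∈ : 0 < k → start ∈ A
    start∈ 0<k = subst (_∈ A) (term-zero start d) (term∈ 0<k)

    -- Otherwise all terms collapse to `start`, and `A` has at most one element instead of `k`.
    second≢start : 2 ≤ k → term start d 1 ≢ start
    second≢start 2≤k e = <⇒≱ (subst (2 ≤_) (sym size) 2≤k) (∣p∣≤1 start λ {x} x∈A →
      let j , x≡ = Equivalence.to (elements x) x∈A in begin
      x                                                      ≡⟨ x≡ ⟩
      term start d (toℕ j)                                   ≡⟨ term-difference start d (toℕ j) ⟩
      term start (difference start (term start d 1)) (toℕ j) ≡⟨ cong (λ b → term start (difference start b) (toℕ j)) e ⟩
      term start (difference start start) (toℕ j)            ≡⟨ term-difference-self start (toℕ j) ⟩
      start                                                  ∎)
      where open ≡-Reasoning

  -- The lower bound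

  χ≥2 : ∀ N k (3≤k : 3 ≤ k) → k ≤ N → 2 ≤ χ N k 3≤k
  χ≥2 N k 3≤k k≤N = go (χ N k 3≤k) (proj₁ (χ-isMinimum N k 3≤k))
    where
    0<N : 0 < N
    0<N = ≤-trans (≤-trans (s≤s z≤n) 3≤k) k≤N
    x₀ : Fin N
    x₀ = fromℕ< 0<N
    initial : Subset N
    initial = subset λ x → toℕ x <? k
    toℕ-jth : ∀ {j} → j < k → toℕ (term x₀ 1 j) ≡ j
    toℕ-jth {j} j<k = let instance _ = nonZeroIndex x₀ in begin
      toℕ (term x₀ 1 j)     ≡⟨ toℕ-term x₀ 1 j ⟩
      (toℕ x₀ + j * 1) % N  ≡⟨ cong₂ (λ a b → (a + b) % N) (toℕ-fromℕ< 0<N) (*-identityʳ j) ⟩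
      j % N                 ≡⟨ m<n⇒m%n≡m (<-≤-trans j<k k≤N) ⟩
      j                     ∎
      where open ≡-Reasoning
    -- `does (toℕ x <? m)` computes by recursion on both numbers, so the tail of the vector is
    -- definitionally a subset of the same shape.
    ∣initial∣ : ∀ {n} m → m ≤ n → ∣ subset {n} (λ x → toℕ x <? m) ∣ ≡ m
    ∣initial∣ {zero}  zero    _         = refl
    ∣initial∣ {suc n} zero    _         = ∣initial∣ {n} zero z≤n
    ∣initial∣ {suc n} (suc m) (s≤s m≤n) = cong suc (∣initial∣ {n} m m≤n)
    initialAP : IsCyclicAP k 1 initial
    initialAP = cyclicAP (∣initial∣ k k≤N) x₀ λ x → mk⇔
      (λ x∈ → let x<k = ∈-subset⁻ (λ x → toℕ x <? k) x∈ in
        fromℕ< x<k , toℕ-injective (sym (trans (toℕ-jth (toℕ<n (fromℕ< x<k))) (toℕ-fromℕ< x<k))))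
      (λ (j , x≡) → ∈-subset⁺ (λ x → toℕ x <? k)
        (subst (_< k) (sym (trans (cong toℕ x≡) (toℕ-jth (toℕ<n j)))) (toℕ<n j)))
    go : ∀ c → APFreePartition N k c → 2 ≤ c
    go 0 (_ , P , _) with () ← proj₁ (IsPartition.covering P x₀)
    -- A single class has to contain every residue, in particular the progression `initial`.
    go 1 (_ , P , free) = contradiction
      (1 , ≤-refl , initial , initialAP , λ {x} _ → everything x) (free zero)
      where
      everything : ∀ x → x ∈ _
      everything x with zero , x∈ ← IsPartition.covering P x = x∈
    go (suc (suc c)) _ = s≤s (s≤s z≤n)

  -- Reduction to the first k² residues

  record InitialColouring (N k : ℕ) : Set where
    constructor initialColouring
    field
      colour : Fin N → Fin 3
      -- Only progressions lying wholly below `k * k` are constrained, but they are progressions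
      -- modulo `N` and may reach their terms by wrapping around.
      free   : ∀ {d A} → IsCyclicAP k d A → ∀ c →
               ¬ (∀ {x} → x ∈ A → toℕ x < k * k × colour x ≡ c)

  -- The residues from k² on are cut into blocks of length k − 1, too short
  -- to contain a k-element set.
  χ≤3+ : ∀ {N k} (3≤k : 3 ≤ k) R → N ≤ k * k + R * (k ∸ 1) → InitialColouring N k →
    χ N k 3≤k ≤ 3 + R
  χ≤3+ {N} {k} 3≤k R N≤ (initialColouring f f-free) = χ≤ 3≤k (join 3 R ∘ g) free
    where
    instance _ = k∸1-nonZero 3≤k
    offset< : ∀ (x : Fin N) → ¬ toℕ x < k * k → toℕ x ∸ k * k < R * (k ∸ 1)
    offset< x x≮ = +-cancelˡ-< (k * k) _ _ (begin-strict
      k * k + (toℕ x ∸ k * k)  ≡⟨ m+[n∸m]≡n (≮⇒≥ x≮) ⟩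
      toℕ x                    <⟨ toℕ<n x ⟩
      N                        ≤⟨ N≤ ⟩
      k * k + R * (k ∸ 1)      ∎)
      where open ≤-Reasoning
    g : Fin N → Fin 3 ⊎ Fin R
    g x with toℕ x <? k * k
    ... | yes _ = inj₁ (f x)
    ... | no x≮ = inj₂ (fromℕ< (m<n*o⇒m/o<n {n = R} (offset< x x≮)))
    g-inj₁ : ∀ x {c} → g x ≡ inj₁ c → toℕ x < k * k × f x ≡ c
    g-inj₁ x e with toℕ x <? k * k
    ... | yes x< = x< , inj₁-injective e
    g-inj₁ x () | no _
    g-inj₂ : ∀ x {r} → g x ≡ inj₂ r → k * k ≤ toℕ x × (toℕ x ∸ k * k) / (k ∸ 1) ≡ toℕ r
    g-inj₂ x e with toℕ x <? k * k
    g-inj₂ x () | yes _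
    ... | no x≮ = ≮⇒≥ x≮ , trans (sym (toℕ-fromℕ< _)) (cong toℕ (inj₂-injective e))
    block : ∀ x {r} → g x ≡ inj₂ r → let lo = k * k + toℕ r * (k ∸ 1) in
      lo ≤ toℕ x × toℕ x < lo + (k ∸ 1)
    block x {r} e with k²≤x , x/≡r ← g-inj₂ x e =
      subst₂ (λ q y → k * k + q * (k ∸ 1) ≤ y) x/≡r y≡ (+-monoʳ-≤ (k * k) (m/n*n≤m y (k ∸ 1))) ,
      subst₂ (λ q y → y < k * k + q * (k ∸ 1) + (k ∸ 1)) x/≡r y≡ (begin-strict
        k * k + y                                           ≡⟨ cong (k * k +_) (m≡m%n+[m/n]*n y (k ∸ 1)) ⟩
        k * k + (y % (k ∸ 1) + y / (k ∸ 1) * (k ∸ 1))       <⟨ +-monoʳ-< (k * k) (+-monoˡ-< _ (m%n<n y (k ∸ 1))) ⟩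
        k * k + (k ∸ 1 + y / (k ∸ 1) * (k ∸ 1))             ≡⟨ cong (k * k +_) (+-comm (k ∸ 1) _) ⟩
        k * k + (y / (k ∸ 1) * (k ∸ 1) + (k ∸ 1))           ≡⟨ +-assoc (k * k) _ _ ⟨
        k * k + y / (k ∸ 1) * (k ∸ 1) + (k ∸ 1)             ∎)
      where
      open ≤-Reasoning
      y = toℕ x ∸ k * k
      y≡ : k * k + y ≡ toℕ x
      y≡ = m+[n∸m]≡n k²≤x
    free : NoMonochromaticAP k (join 3 R ∘ g)
    free {A = A} ap i mono = part (splitAt 3 i) refl
      where
      g≡ : ∀ {x} → x ∈ A → g x ≡ splitAt 3 i
      g≡ x∈A = trans (sym (splitAt-join 3 R _)) (cong (splitAt 3) (mono x∈A))
      part : ∀ s → splitAt 3 i ≡ s → _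
      part (inj₁ c) e = f-free ap c λ x∈A → g-inj₁ _ (trans (g≡ x∈A) e)
      part (inj₂ r) e = <⇒≱ (k∸1<k 3≤k) (subst (_≤ k ∸ 1) (IsCyclicAP.size ap)
        (∣interval∣≤ A _ (k ∸ 1) λ x∈A → block _ (trans (g≡ x∈A) e)))
        where
        k∸1<k : ∀ {k} → 3 ≤ k → k ∸ 1 < k
        k∸1<k (s≤s _) = ≤-refl

  -- Large k: the union bound

  -- A pair `(A , c)` encodes the event that all of `A` gets colour `c`. Fixing `c` in advance makes
  -- the event easy to update when a single position is coloured.
  Constraint : ℕ → Set
  Constraint n = Subset n × Fin 3

  Violates : ∀ {n} → (Fin n → Fin 3) → Constraint n → Set
  Violates f (A , c) = ∀ {x} → x ∈ A → f x ≡ c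

  -- 3ⁿ times the expected number of constraints violated by a random colouring.
  weight : ∀ {n} → List (Constraint n) → ℕ
  weight = sum ∘ map (λ (A , _) → 3 ^ ∣ ∁ A ∣)

  -- What remains after the first position gets colour `c₀`: a constraint whose set contains that
  -- position with another colour can no longer be violated and is dropped.
  restrict : ∀ {n} → Fin 3 → List (Constraint (suc n)) → List (Constraint n)
  restrict c₀ [] = []
  restrict c₀ ((outside ∷ A , c) ∷ L) = (A , c) ∷ restrict c₀ L
  restrict c₀ ((inside ∷ A , c) ∷ L) =
    if does (c₀ Fin.≟ c) then (A , c) ∷ restrict c₀ L else restrict c₀ L

  -- The law of total expectation. A constraint avoiding the first position survives in all three
  -- branches with a third of its weight; one containing it survives in a single branch with its
  -- weight unchanged.
  weight-restrict : ∀ {n} (L : List (Constraint (suc n))) →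
    weight L ≡ weight (restrict 0F L) + weight (restrict 1F L) + weight (restrict 2F L)
  weight-restrict [] = refl
  weight-restrict ((outside ∷ A , c) ∷ L) = trans
    (cong (3 ^ suc ∣ ∁ A ∣ +_) (weight-restrict L))
    (shuffle (3 ^ ∣ ∁ A ∣) (weight (restrict 0F L)) (weight (restrict 1F L)) (weight (restrict 2F L)))
    where
    shuffle : ∀ w x y z → 3 * w + (x + y + z) ≡ w + x + (w + y) + (w + z)
    shuffle = solve-∀
  weight-restrict ((inside ∷ A , 0F) ∷ L) = trans
    (cong (3 ^ ∣ ∁ A ∣ +_) (weight-restrict L))
    (shuffle (3 ^ ∣ ∁ A ∣) (weight (restrict 0F L)) (weight (restrict 1F L)) (weight (restrict 2F L)))
    where
    shuffle : ∀ w x y z → w + (x + y + z) ≡ w + x + y + z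
    shuffle = solve-∀
  weight-restrict ((inside ∷ A , 1F) ∷ L) = trans
    (cong (3 ^ ∣ ∁ A ∣ +_) (weight-restrict L))
    (shuffle (3 ^ ∣ ∁ A ∣) (weight (restrict 0F L)) (weight (restrict 1F L)) (weight (restrict 2F L)))
    where
    shuffle : ∀ w x y z → w + (x + y + z) ≡ x + (w + y) + z
    shuffle = solve-∀
  weight-restrict ((inside ∷ A , 2F) ∷ L) = trans
    (cong (3 ^ ∣ ∁ A ∣ +_) (weight-restrict L))
    (shuffle (3 ^ ∣ ∁ A ∣) (weight (restrict 0F L)) (weight (restrict 1F L)) (weight (restrict 2F L)))
    where
    shuffle : ∀ w x y z → w + (x + y + z) ≡ x + y + (w + z)
    shuffle = solve-∀

  pigeonhole₃ : ∀ (w : Fin 3 → ℕ) v → w 0F + w 1F + w 2F < 3 * v → ∃[ c ] w c < v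
  pigeonhole₃ w v Σ<3v with w 0F <? v | w 1F <? v | w 2F <? v
  ... | yes lt | _      | _      = _ , lt
  ... | no _   | yes lt | _      = _ , lt
  ... | no _   | no _   | yes lt = _ , lt
  ... | no p   | no q   | no r   = contradiction Σ<3v (≤⇒≯ (begin
    3 * v               ≡⟨ triple v ⟩
    v + v + v           ≤⟨ +-mono-≤ (+-mono-≤ (≮⇒≥ p) (≮⇒≥ q)) (≮⇒≥ r) ⟩
    w 0F + w 1F + w 2F  ∎))
    where
    open ≤-Reasoning
    triple : ∀ v → 3 * v ≡ v + v + v
    triple = solve-∀

  unrestrict : ∀ {n} {c₀} {f : Fin n → Fin 3} (L : List (Constraint (suc n))) →
    All (¬_ ∘ Violates f) (restrict c₀ L) → All (¬_ ∘ Violates (c₀ Functional.∷ f)) L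
  unrestrict [] [] = []
  unrestrict ((outside ∷ A , c) ∷ L) (¬v ∷ ¬vs) =
    (λ v → ¬v (v ∘ there)) ∷ unrestrict L ¬vs
  unrestrict {c₀ = c₀} ((inside ∷ A , c) ∷ L) ¬vs with c₀ Fin.≟ c
  unrestrict ((inside ∷ A , c) ∷ L) (¬v ∷ ¬vs) | yes _    = (λ v → ¬v (v ∘ there)) ∷ unrestrict L ¬vs
  unrestrict ((inside ∷ A , c) ∷ L) ¬vs        | no c₀≢c = (λ v → c₀≢c (v here)) ∷ unrestrict L ¬vs

  -- Conditional expectations: the colours are chosen one at a time, never
  -- increasing the expected number of violations.
  union-bound : ∀ {n} (L : List (Constraint n)) → weight L < 3 ^ n →
    ∃[ f ] All (¬_ ∘ Violates f) L
  union-bound {zero}  [] _ = (λ ()) , []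
  -- With no positions left each constraint weighs 1, which is already `3 ^ 0`, so the strict bound
  -- forces the list to be empty.
  union-bound {zero}  (([] , _) ∷ _) (s≤s ())
  union-bound {suc n} L w<
    with c , lt ← pigeonhole₃ (λ c → weight (restrict c L)) (3 ^ n) (subst (_< 3 ^ suc n) (weight-restrict L) w<)
    with f , ¬vs ← union-bound (restrict c L) lt
    = c Functional.∷ f , unrestrict L ¬vs

  -- Each `k`-element set contributes `3 ^ (n ∸ k)`; multiplying by `3 ^ k` keeps truncated
  -- subtraction out of the statement.
  weight-uniform : ∀ {n k} {L : List (Constraint n)} → All (λ (A , _) → ∣ A ∣ ≡ k) L →
    weight L * 3 ^ k ≡ length L * 3 ^ n
  weight-uniform [] = refl
  weight-uniform {n} {k} {(A , _) ∷ L} (∣A∣≡k ∷ sizes) = begin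
    (3 ^ ∣ ∁ A ∣ + weight L) * 3 ^ k          ≡⟨ *-distribʳ-+ (3 ^ k) (3 ^ ∣ ∁ A ∣) (weight L) ⟩
    3 ^ ∣ ∁ A ∣ * 3 ^ k + weight L * 3 ^ k    ≡⟨ cong₂ _+_ head (weight-uniform sizes) ⟩
    3 ^ n + length L * 3 ^ n                  ∎
    where
    open ≡-Reasoning
    head : 3 ^ ∣ ∁ A ∣ * 3 ^ k ≡ 3 ^ n
    head = begin
      3 ^ ∣ ∁ A ∣ * 3 ^ k  ≡⟨ ^-distribˡ-+-* 3 ∣ ∁ A ∣ k ⟨
      3 ^ (∣ ∁ A ∣ + k)    ≡⟨ cong (λ e → 3 ^ (e + k)) (trans (∣∁p∣≡n∸∣p∣ A) (cong (n ∸_) ∣A∣≡k)) ⟩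
      3 ^ (n ∸ k + k)      ≡⟨ cong (3 ^_) (m∸n+n≡m (subst (_≤ n) ∣A∣≡k (∣p∣≤n A))) ⟩
      3 ^ n                ∎

  length-cartesianProductWith : ∀ {A B C : Set} (f : A → B → C) xs ys →
    length (cartesianProductWith f xs ys) ≡ length xs * length ys
  length-cartesianProductWith f []       ys = refl
  length-cartesianProductWith f (x ∷ xs) ys = trans (length-++ (map (f x) ys))
    (cong₂ _+_ (length-map (f x) ys) (length-cartesianProductWith f xs ys))

  -- Equality holds at `k = 9`. For the induction step, 2(k + 1)² ≤ 3k² when k ≥ 9, and squaring
  -- gives 4(k + 1)⁴ ≤ 9k⁴ ≤ 12k⁴.
  3k⁴≤3^k : ∀ {k} → 9 ≤ k → 3 * (k * k * (k * k)) ≤ 3 ^ k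
  3k⁴≤3^k {k} 9≤k with i , refl ← m≤n⇒∃[o]m+o≡n 9≤k = go i
    where
    square : ∀ m n → m * n * (m * n) ≡ m * m * (n * n)
    square = solve-∀
    fourth-power : ∀ r s → 2 * s ≤ 3 * r → s * s ≤ 3 * (r * r)
    fourth-power r s 2s≤3r = *-cancelˡ-≤ 4 (begin
      4 * (s * s)          ≡⟨ square 2 s ⟨
      2 * s * (2 * s)      ≤⟨ *-mono-≤ 2s≤3r 2s≤3r ⟩
      3 * r * (3 * r)      ≡⟨ square 3 r ⟩
      9 * (r * r)          ≤⟨ *-monoˡ-≤ (r * r) (m≤m+n 9 3) ⟩
      12 * (r * r)         ≡⟨ *-assoc 4 3 (r * r) ⟩
      4 * (3 * (r * r))    ∎)
      where open ≤-Reasoning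
    expand : ∀ i → 2 * ((10 + i) * (10 + i)) + (43 + 14 * i + i * i) ≡ 3 * ((9 + i) * (9 + i))
    expand = solve-∀
    go : ∀ i → let k = 9 + i in 3 * (k * k * (k * k)) ≤ 3 ^ k
    go zero    = ≤-refl
    go (suc i) = *-monoʳ-≤ 3 (≤-trans
      (fourth-power ((9 + i) * (9 + i)) ((10 + i) * (10 + i))
        (≤-trans (m≤m+n _ _) (≤-reflexive (expand i))))
      (go i))

  module _ {N : ℕ} (k : ℕ) where

    onSegment? : ∀ (a b : Fin N) → Decidable λ x → ∃[ j ] x ≡ term a (difference a b) (toℕ {k} j)
    onSegment? a b x = Fin.any? λ j → x Fin.≟ term a (difference a b) (toℕ j)

    -- The progression with first two terms a and b.
    segment : Fin N → Fin N → Subset N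
    segment a b = subset (onSegment? a b)

    segment-isCyclicAP : ∀ a b → ∣ segment a b ∣ ≡ k → IsCyclicAP k (difference a b) (segment a b)
    segment-isCyclicAP a b size = cyclicAP size a λ x →
      mk⇔ (∈-subset⁻ (onSegment? a b)) (∈-subset⁺ (onSegment? a b))

    cyclicAP≡segment : ∀ {d A} (ap : IsCyclicAP k d A) → let open IsCyclicAP ap in
      A ≡ segment start (term start d 1)
    cyclicAP≡segment {d} (cyclicAP _ t elements) = ⊆-antisym
      (λ {x} x∈A → let j , x≡ = Equivalence.to (elements x) x∈A in
        ∈-subset⁺ (onSegment? t _) (j , trans x≡ (term-difference t d (toℕ j))))
      (λ {x} x∈S → let j , x≡ = ∈-subset⁻ (onSegment? t _) x∈S in
        Equivalence.from (elements x) (j , trans x≡ (sym (term-difference t d (toℕ j)))))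

  -- A progression below `k * k` has its first two terms in `pool`, so it is among the k⁴ segments
  -- spanned by pairs from `pool`. Each progression kept by the size filter yields three
  -- constraints, one per colour.
  randomColouring : ∀ {N k} → 3 ≤ k → k * k ≤ N → 3 * (k * k * (k * k)) ≤ 3 ^ k → InitialColouring N k
  randomColouring {N} {k} 3≤k k²≤N 3k⁴≤3^k = initialColouring f free
    where
    2≤k : 2 ≤ k
    2≤k = <⇒≤ 3≤k
    0<k : 0 < k
    0<k = <⇒≤ 2≤k
    pool : List (Fin N)
    pool = map (λ x → inject≤ x k²≤N) (allFin (k * k))
    ∈pool : ∀ {x} → toℕ x < k * k → x ∈ˡ pool
    ∈pool x<k² = subst (_∈ˡ pool)
      (toℕ-injective (trans (toℕ-inject≤ (fromℕ< x<k²) k²≤N) (toℕ-fromℕ< x<k²)))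
      (∈-map⁺ (λ x → inject≤ x k²≤N) (∈-allFin (fromℕ< x<k²)))
    size? : Decidable λ (A : Subset N) → ∣ A ∣ ≡ k
    size? A = ∣ A ∣ ≟ k
    segments progressions : List (Subset N)
    segments = cartesianProductWith (segment k) pool pool
    progressions = filter size? segments
    x₀ : Fin N
    x₀ = inject≤ (fromℕ< (*-mono-≤ 0<k 0<k)) k²≤N
    x₀∈ : x₀ ∈ˡ pool
    x₀∈ = ∈-map⁺ (λ x → inject≤ x k²≤N) (∈-allFin _)
    -- A pair with equal entries spans no progression, so there are strictly fewer than k⁴ of them.
    -- The strictness matters: at `k = 9` the hypothesis `3k⁴≤3^k` is an equality, while the union
    -- bound needs a strict inequality.
    degenerate : ∣ segment k x₀ x₀ ∣ ≢ k
    degenerate size = second≢start (segment-isCyclicAP k x₀ x₀ size) 2≤k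
      (term-difference-self x₀ 1)
    ∣progressions∣< : length progressions < k * k * (k * k)
    ∣progressions∣< = begin-strict
      length progressions                            <⟨ filter-notAll size? segments
                                                         (lose (∈-cartesianProductWith⁺ (segment k) x₀∈ x₀∈) degenerate) ⟩
      length segments                                ≡⟨ length-cartesianProductWith (segment k) pool pool ⟩
      length pool * length pool                      ≡⟨ cong (λ l → l * l) (trans (length-map _ (allFin (k * k))) (length-tabulate {n = k * k} _)) ⟩
      k * k * (k * k)                                ∎
      where open ≤-Reasoning
    constraints : List (Constraint N)
    constraints = cartesianProduct progressions (allFin 3)
    weight< : weight constraints < 3 ^ N
    weight< = *-cancelʳ-< (3 ^ k) (weight constraints) (3 ^ N) (begin-strict
      weight constraints * 3 ^ k       ≡⟨ weight-uniform (All.tabulate λ Ac∈ →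
                                            proj₂ (∈-filter⁻ size? {xs = segments} (proj₁ (∈-cartesianProduct⁻ progressions (allFin 3) Ac∈)))) ⟩
      length constraints * 3 ^ N       ≡⟨ cong (_* 3 ^ N) (length-cartesianProductWith _,_ progressions (allFin 3)) ⟩
      length progressions * 3 * 3 ^ N  <⟨ *-monoˡ-< (3 ^ N) {{m^n≢0 3 N}} (*-monoˡ-< 3 ∣progressions∣<) ⟩
      k * k * (k * k) * 3 * 3 ^ N      ≡⟨ cong (_* 3 ^ N) (*-comm (k * k * (k * k)) 3) ⟩
      3 * (k * k * (k * k)) * 3 ^ N    ≤⟨ *-monoˡ-≤ (3 ^ N) 3k⁴≤3^k ⟩
      3 ^ k * 3 ^ N                    ≡⟨ *-comm (3 ^ k) (3 ^ N) ⟩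
      3 ^ N * 3 ^ k                    ∎)
      where open ≤-Reasoning
    f = proj₁ (union-bound constraints weight<)
    free : ∀ {d A} → IsCyclicAP k d A → ∀ c → ¬ (∀ {x} → x ∈ A → toℕ x < k * k × f x ≡ c)
    free {A = A} ap c mono = All.lookup (proj₂ (union-bound constraints weight<))
      (∈-cartesianProduct⁺ (∈-filter⁺ size? A∈ (IsCyclicAP.size ap)) (∈-allFin c))
      (proj₂ ∘ mono)
      where
      A∈ : A ∈ˡ segments
      A∈ = subst (_∈ˡ segments) (sym (cyclicAP≡segment k ap))
        (∈-cartesianProductWith⁺ (segment k)
          (∈pool (proj₁ (mono (start∈ ap 0<k))))
          (∈pool (proj₁ (mono (term∈ ap 2≤k)))))

  -- Small k: tables

  -- The colour of x is the x-th decimal digit of T, counted from the right.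
  digit : ℕ → ℕ → Fin 3
  digit T x = (T / 10 ^ x % 10) mod 3
    where instance _ = m^n≢0 10 x

  Monochromatic : (T k N a d : ℕ) .{{_ : NonZero N}} → Set
  Monochromatic T k N a d = ∀ {j} → j < k →
    let x = (a + j * d) % N in x < k * k × digit T x ≡ digit T a

  monochromatic? : ∀ T k N a d .{{_ : NonZero N}} → Dec (Monochromatic T k N a d)
  monochromatic? T k N a d = allUpTo?
    (λ j → let x = (a + j * d) % N in x <? k * k ×-dec digit T x Fin.≟ digit T a) k

  -- N runs through the moduli m k with k < m ≤ 2k.  Excluding progressions
  -- with repeated terms too is stronger than needed, but only requires
  -- comparing the first two terms.
  Valid : ℕ → (k : ℕ) .{{_ : NonZero k}} → Set
  Valid T k@(suc _) = ∀ {i} → i < k → let N = suc (k + i) * k in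
    ∀ {a} → a < k * k → ∀ {b} → b < k * k → a ≢ b → ¬ Monochromatic T k N a (b + (N ∸ a))

  valid? : ∀ T k .{{_ : NonZero k}} → Dec (Valid T k)
  valid? T k@(suc _) = allUpTo? (λ i → let N = suc (k + i) * k in
    allUpTo? (λ a → allUpTo? (λ b →
      ¬? (a ≟ b) →-dec ¬? (monochromatic? T k N a (b + (N ∸ a)))) (k * k)) (k * k)) k

  -- A progression inside [0, n) does not wrap around when 2n ≤ N, and hence
  -- is also a progression modulo every M ≥ n.
  module _ {N : ℕ} (t : Fin N) (d k n : ℕ) (2≤k : 2 ≤ k) (2n≤N : n + n ≤ N)
           (small : ∀ {j} → j < k → toℕ (term t d j) < n) where

    private
      instance
        N≢0 : NonZero N
        N≢0 = nonZeroIndex t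
      a b : ℕ
      a = toℕ t
      b = toℕ (term t d 1)
      x : ℕ → ℕ
      x j = toℕ (term t d j)

    start<n : a < n
    start<n = subst (_< n) (cong toℕ (term-zero t d)) (small (<⇒≤ 2≤k))

    -- Both sides are congruent modulo `N` and, as sums of two numbers below `n`, are less than `N`;
    -- hence they are equal as natural numbers.
    step : ∀ {j} → suc j < k → x (suc j) + a ≡ x j + b
    step {j} 1+j<k = begin
      x (suc j) + a                        ≡⟨ m<n⇒m%n≡m (<-≤-trans (+-mono-< (small 1+j<k) start<n) 2n≤N) ⟨
      (x (suc j) + a) % N                  ≡⟨ cong (λ y → (y + a) % N) (toℕ-term t d (suc j)) ⟩
      ((a + suc j * d) % N + a) % N        ≡⟨ %-cong-+ {n = a} N (m%n%n≡m%n (a + suc j * d) N) refl ⟩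
      (a + suc j * d + a) % N              ≡⟨ cong (_% N) (shuffle a j d) ⟩
      (a + j * d + (a + 1 * d)) % N        ≡⟨ %-cong-+ N (m%n%n≡m%n (a + j * d) N) (m%n%n≡m%n (a + 1 * d) N) ⟨
      ((a + j * d) % N + (a + 1 * d) % N) % N
                                           ≡⟨ cong₂ (λ y z → (y + z) % N) (toℕ-term t d j) (toℕ-term t d 1) ⟨
      (x j + b) % N                        ≡⟨ m<n⇒m%n≡m (<-≤-trans (+-mono-< (small (<-trans (n<1+n j) 1+j<k)) (small 2≤k)) 2n≤N) ⟩
      x j + b                              ∎
      where
      open ≡-Reasoning
      shuffle : ∀ a j d → a + suc j * d + a ≡ a + j * d + (a + 1 * d)
      shuffle = solve-∀

    -- This is x_j = a + j(b - a), rearranged without subtraction since `b` may be smaller than `a`.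
    unwrapped : ∀ {j} → j < k → x j + j * a ≡ a + j * b
    unwrapped {zero} 0<k = cong (λ y → toℕ y + 0) (term-zero t d)
    unwrapped {suc j} 1+j<k = begin
      x (suc j) + (a + j * a)  ≡⟨ +-assoc (x (suc j)) a (j * a) ⟨
      x (suc j) + a + j * a    ≡⟨ cong (_+ j * a) (step 1+j<k) ⟩
      x j + b + j * a          ≡⟨ swap (x j) b (j * a) ⟩
      x j + j * a + b          ≡⟨ cong (_+ b) (unwrapped (<-trans (n<1+n j) 1+j<k)) ⟩
      a + j * b + b            ≡⟨ swap′ a (j * b) b ⟩
      a + (b + j * b)          ∎
      where
      open ≡-Reasoning
      swap : ∀ u v w → u + v + w ≡ u + w + v
      swap = solve-∀
      swap′ : ∀ u v w → u + v + w ≡ u + (w + v)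
      swap′ = solve-∀

    -- Modulo `M`, `b + (M ∸ a)` represents b - a, so by `unwrapped` the left side is `x j + j * M`
    -- reduced modulo `M`, and `x j < n ≤ M`.
    term-changeModulus : ∀ M .{{_ : NonZero M}} → n ≤ M → ∀ {j} → j < k →
      (a + j * (b + (M ∸ a))) % M ≡ x j
    term-changeModulus M n≤M {j} j<k = begin
      (a + j * (b + (M ∸ a))) % M          ≡⟨ cong (_% M) (distrib a j b (M ∸ a)) ⟩
      (a + j * b + j * (M ∸ a)) % M        ≡⟨ cong (λ y → (y + j * (M ∸ a)) % M) (unwrapped j<k) ⟨
      (x j + j * a + j * (M ∸ a)) % M      ≡⟨ cong (_% M) (collect (x j) j a (M ∸ a)) ⟩
      (x j + j * (a + (M ∸ a))) % M        ≡⟨ cong (λ y → (x j + j * y) % M) (m+[n∸m]≡n (<⇒≤ (<-≤-trans start<n n≤M))) ⟩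
      (x j + j * M) % M                    ≡⟨ [m+kn]%n≡m%n (x j) j M ⟩
      x j % M                              ≡⟨ m<n⇒m%n≡m (<-≤-trans (small j<k) n≤M) ⟩
      x j                                  ∎
      where
      open ≡-Reasoning
      distrib : ∀ a j b u → a + j * (b + u) ≡ a + j * b + j * u
      distrib = solve-∀
      collect : ∀ x j a u → x + j * a + j * u ≡ x + j * (a + u)
      collect = solve-∀

  -- For `i < k` the table has been checked at the modulus itself. For larger `i` the modulus is at
  -- least 2k², so a monochromatic progression carries over to a checked modulus.
  tableColouring : ∀ T k .{{_ : NonZero k}} → 2 ≤ k → Valid T k → ∀ i →
    InitialColouring (suc (k + i) * k) k
  tableColouring T k@(suc k-1) 2≤k valid i = initialColouring (digit T ∘ toℕ) free
    where
    N = suc (k + i) * k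
    free : ∀ {d A} → IsCyclicAP k d A → ∀ c →
      ¬ (∀ {x : Fin N} → x ∈ A → toℕ x < k * k × digit T (toℕ x) ≡ c)
    free {d} ap c mono = case (i <? k)
      where
      t = IsCyclicAP.start ap
      a = toℕ t
      b = toℕ (term t d 1)
      small : ∀ {j} → j < k → toℕ (term t d j) < k * k
      small j<k = proj₁ (mono (term∈ ap j<k))
      monochromatic : ∀ M .{{_ : NonZero M}} →
        (∀ {j} → j < k → (a + j * (b + (M ∸ a))) % M ≡ toℕ (term t d j)) →
        Monochromatic T k M a (b + (M ∸ a))
      monochromatic M x≡ {j} j<k = subst (λ x → x < k * k × digit T x ≡ digit T a) (sym (x≡ j<k))
        (small j<k , trans (proj₂ (mono (term∈ ap j<k))) (sym (proj₂ (mono (start∈ ap (s≤s z≤n))))))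
      absurd : ∀ {i} → i < k → let M = suc (k + i) * k in
        ¬ (∀ {j} → j < k → (a + j * (b + (M ∸ a))) % M ≡ toℕ (term t d j))
      absurd {i} i<k x≡ = valid i<k (proj₁ (mono (start∈ ap (s≤s z≤n)))) (small 2≤k)
        (λ a≡b → second≢start ap 2≤k (toℕ-injective (sym a≡b)))
        (monochromatic (suc (k + i) * k) x≡)
      case : Dec (i < k) → _
      case (yes i<k) = absurd i<k λ {j} _ → sym (trans
        (cong toℕ (term-difference t d j)) (toℕ-term t (difference t (term t d 1)) j))
      -- The index `k-1` selects the largest checked modulus, 2k · k.
      case (no i≮k) = absurd {k-1} ≤-refl (term-changeModulus t d k (k * k) 2≤k 2k²≤N small
        (suc (k + k-1) * k) (*-monoˡ-≤ k (≤-trans (m≤m+n k k-1) (n≤1+n _))))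
        where
        2k²≤N : k * k + k * k ≤ N
        2k²≤N = begin
          k * k + k * k    ≡⟨ *-distribʳ-+ k k k ⟨
          (k + k) * k      ≤⟨ *-monoˡ-≤ k (≤-trans (+-monoʳ-≤ k (≮⇒≥ i≮k)) (n≤1+n (k + i))) ⟩
          suc (k + i) * k  ∎
          where open ≤-Reasoning

  -- The colourings were found by local search.
  table : ∀ k .{{_ : NonZero k}} → 3 ≤ k → k < 9 → ∃[ T ] Valid T k
  table 0 () _
  table 1 (s≤s ()) _
  table 2 (s≤s (s≤s ())) _
  table k@(suc (suc (suc n))) _ k<9 = go n (+-cancelˡ-< 3 n 6 k<9)
    where
    go : ∀ n → n < 6 → ∃[ T ] Valid T (3 + n)
    go 0 _ = T , λ {i} → toWitness {a? = valid? T 3} _ {i}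
      where T = 120120201
    go 1 _ = T , λ {i} → toWitness {a? = valid? T 4} _ {i}
      where T = 1112021011220020
    go 2 _ = T , λ {i} → toWitness {a? = valid? T 5} _ {i}
      where T = 2002220200112021111001111
    go 3 _ = T , λ {i} → toWitness {a? = valid? T 6} _ {i}
      where T = 211212212221112221200102020000100000
    go 4 _ = T , λ {i} → toWitness {a? = valid? T 7} _ {i}
      where T = 1100202211202210102212020102221201102211110221110
    go 5 _ = T , λ {i} → toWitness {a? = valid? T 8} _ {i}
      where T = 122212221220122210221200202211102112001101010111000101112111011
    go (suc (suc (suc (suc (suc (suc n)))))) n<6 = contradiction n<6 (m+n≮m 6 n)

  -- The threshold 9 is the least `k ≥ 3` with k⁴ ≤ 3^(k-1), the inequality on which the union bound
  -- rests.
  threeColours : ∀ k m → 3 ≤ k → k < m → InitialColouring (m * k) k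
  threeColours k m 3≤k k<m with 9 ≤? k
  ... | yes 9≤k = randomColouring 3≤k (*-monoˡ-≤ k (<⇒≤ k<m)) (3k⁴≤3^k 9≤k)
  ... | no  9≰k with i , refl ← m≤n⇒∃[o]m+o≡n k<m =
    let instance _ = >-nonZero (<⇒≤ (<⇒≤ 3≤k))
        T , valid = table k 3≤k (≰⇒> 9≰k)
    in tableColouring T k (<⇒≤ 3≤k) valid i

-- The ceiling and the two bounds together

open import Data.Nat.Base as ℕ using (ℕ; _∸_)
open import Data.Integer.Base using (+_; -[1+_]; _+_; _-_; -_; _*_; _≤_; +≤+)
open import Data.Integer.DivMod as ℤ using ([n/d]*d≤n)
import Data.Integer.Properties as ℤ
import Data.Nat.Properties as ℕ
open import Data.Rational.Unnormalised.Base using (_/_; ceiling)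
open import Data.Product.Base using (_×_; _,_; ∃-syntax)
open import Relation.Binary.PropositionalEquality
open Colourings using (χ≥2; χ≤3+; threeColours)

-- The ceiling is by definition minus the floor of `- n / d`, so the floor inequality, negated,
-- gives `n ≤ - z * d`. As `n` is nonnegative and `d` positive, `- z` cannot be negative.
ceiling-bound : ∀ n d .{{_ : ℕ.NonZero d}} → ∃[ R ] + R ≡ ceiling (+ n / d) × n ℕ.≤ R ℕ.* d
ceiling-bound n d@(ℕ.suc _) = natural (- z) n≤
  where
  z = (- + n) ℤ./ + d
  n≤ : + n ≤ - z * + d
  n≤ = subst₂ _≤_ (ℤ.neg-involutive (+ n)) (ℤ.neg-distribˡ-* z (+ d)) (ℤ.neg-mono-≤ ([n/d]*d≤n (- + n) (+ d)))
  natural : ∀ w → + n ≤ w * + d → ∃[ R ] + R ≡ w × n ℕ.≤ R ℕ.* d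
  natural (+ R) n≤ = R , refl , ℤ.drop‿+≤+ (subst (+ n ≤_) (sym (ℤ.pos-* R d)) n≤)
  natural -[1+ _ ] ()

proposition4p5 : (k m : ℕ) (3≤k : 3 ℕ.≤ k) → k ℕ.< m →
    (2 ℕ.≤ χ (m ℕ.* k) k 3≤k) ×
    (+ χ (m ℕ.* k) k 3≤k
    ≤ + 3 + ceiling (_/_ ((+ m - + k) * + k) (k ∸ 1) {{k∸1-nonZero 3≤k}}))
proposition4p5 k m 3≤k k<m = χ≥2 (m ℕ.* k) k 3≤k k≤mk , upper
  where
  instance _ = k∸1-nonZero 3≤k
  k≤m : k ℕ.≤ m
  k≤m = ℕ.<⇒≤ k<m
  k≤mk : k ℕ.≤ m ℕ.* k
  k≤mk = ℕ.m≤n*m k m {{ℕ.>-nonZero (ℕ.≤-<-trans ℕ.z≤n k<m)}}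
  -- Since `k ≤ m`, the integer difference agrees with truncated subtraction.
  numerator : + ((m ∸ k) ℕ.* k) ≡ (+ m - + k) * + k
  numerator = trans (ℤ.pos-* (m ∸ k) k)
    (cong (_* + k) (sym (trans (ℤ.m-n≡m⊖n m k) (ℤ.⊖-≥ k≤m))))
  upper : + χ (m ℕ.* k) k 3≤k ≤ + 3 + ceiling (((+ m - + k) * + k) / (k ∸ 1))
  upper with R , R≡ , rest≤ ← ceiling-bound ((m ∸ k) ℕ.* k) (k ∸ 1) =
    subst (λ z → + χ (m ℕ.* k) k 3≤k ≤ + 3 + z)
      (trans R≡ (cong (λ n → ceiling (n / (k ∸ 1))) numerator))
      (+≤+ (χ≤3+ 3≤k R mk≤ (threeColours k m 3≤k k<m)))
    where
    -- The residues beyond the first k² number (m - k)k, and `R` blocks of length k - 1 cover them.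
    mk≤ : m ℕ.* k ℕ.≤ k ℕ.* k ℕ.+ R ℕ.* (k ∸ 1)
    mk≤ = begin
      m ℕ.* k                        ≡⟨ cong (ℕ._* k) (ℕ.m+[n∸m]≡n k≤m) ⟨
      (k ℕ.+ (m ∸ k)) ℕ.* k          ≡⟨ ℕ.*-distribʳ-+ k k (m ∸ k) ⟩
      k ℕ.* k ℕ.+ (m ∸ k) ℕ.* k      ≤⟨ ℕ.+-monoʳ-≤ (k ℕ.* k) rest≤ ⟩
      k ℕ.* k ℕ.+ R ℕ.* (k ∸ 1)      ∎
      where open ℕ.≤-Reasoning
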